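{- Let $G=(V,E)$ be any finite simple graph with $|V|=n\geq 1$ and $|E|=m$. Then for any integer $k\geq 3$, $$s_k(G)\geq \frac{2m}{n(k-2)}+1 .$$
   Context: $P_k$ denotes the path on $k$ vertices. A $P_k$-coloring of a graph $G$ is a proper vertex coloring of $G$ in which no copy of $P_k$ in $G$ (as a subgraph, not necessarily induced) is bicolored, i.e. has its vertices colored using only two colors. The $P_k$-chromatic number $s_k(G)$ is the minimum number of colors in a $P_k$-coloring of $G$. -}

module Defs where

open import Level using (0ℓ)
open import Data.Nat.Base using (ℕ; zero; suc; _*_; _∸_; _≤_; z≤n; s≤s; NonZero; >-nonZero)
import Data.Nat.Properties as ℕ
open import Data.Fin.Base as Fin using (Fin; zero; suc; toℕ; finToFun; funToFin)
import Data.Fin.Properties as Fin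
open import Data.List.Base using (List; length; filter; cartesianProduct; allFin)
open import Data.Product.Base using (∃; ∃₂; _×_; _,_; proj₁; proj₂)
open import Data.Sum.Base using (_⊎_; inj₁; inj₂; swap)
open import Function.Base using (_∘_; id)
open import Function.Definitions using (Injective)
open import Relation.Binary.Core using (Rel)
import Relation.Binary.Definitions as Binary
open import Relation.Binary.PropositionalEquality using (_≡_; _≢_; _≗_; refl; sym; trans; cong; subst; subst₂)
open import Relation.Nullary using (¬_; Dec; yes; no; contradiction)
open import Relation.Nullary.Decidable using (map′; ¬?; _×-dec_; _⊎-dec_; _→-dec_)
open import Relation.Unary using (Pred; Decidable)

-- Finite simple graphs, with the vertices enumerated as Fin n.

record Graph (n : ℕ) : Set₁ where
  field
    Adj    : Rel (Fin n) 0ℓ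
    adj?   : Binary.Decidable Adj
    symm   : Binary.Symmetric Adj
    irrefl : ∀ {v} → ¬ Adj v v

open Graph

-- Each edge {u , v} is listed exactly once, as the pair with u < v.
edges : ∀ {n} → Graph n → List (Fin n × Fin n)
edges {n} G =
  filter (λ (u , v) → (u Fin.<? v) ×-dec adj? G u v)
         (cartesianProduct (allFin n) (allFin n))

∣E∣ : ∀ {n} → Graph n → ℕ
∣E∣ G = length (edges G)

Path : ∀ k → Graph k
Path k .Adj i j = toℕ j ≡ suc (toℕ i) ⊎ toℕ i ≡ suc (toℕ j)
Path k .adj? i j = (toℕ j ℕ.≟ suc (toℕ i)) ⊎-dec (toℕ i ℕ.≟ suc (toℕ j))
Path k .symm = swap
Path k .irrefl (inj₁ eq) = ℕ.1+n≢n (sym eq)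
Path k .irrefl (inj₂ eq) = ℕ.1+n≢n (sym eq)

-- f exhibits a copy of H as a subgraph of G, not necessarily induced:
-- non-edges of H may be sent to edges of G.
record IsCopy {h n} (H : Graph h) (G : Graph n) (f : Fin h → Fin n) : Set where
  field
    injective : Injective _≡_ _≡_ f
    preserves : ∀ {i j} → Adj H i j → Adj G (f i) (f j)

Proper : ∀ {n c} → Graph n → (Fin n → Fin c) → Set
Proper G col = ∀ {u v} → Adj G u v → col u ≢ col v

-- The colours a and b may coincide, so this reads "at most two colours".  For a
-- copy of a path with at least two vertices in a properly coloured graph the
-- number of colours is then exactly two.
Bicolored : ∀ {h n c} → (Fin n → Fin c) → (Fin h → Fin n) → Set
Bicolored col f = ∃₂ λ a b → ∀ i → col (f i) ≡ a ⊎ col (f i) ≡ b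

record IsPathColoring (k : ℕ) {n c} (G : Graph n) (col : Fin n → Fin c) : Set where
  field
    proper      : Proper G col
    noBicolored : ∀ {f} → IsCopy (Path k) G f → ¬ Bicolored col f

PathColorable : ℕ → ∀ {n} → Graph n → ℕ → Set
PathColorable k {n} G c = ∃ λ (col : Fin n → Fin c) → IsPathColoring k G col

IsLeast : Pred ℕ 0ℓ → ℕ → Set
IsLeast P m = P m × (∀ {x} → P x → m ≤ x)

least : ∀ {P : Pred ℕ 0ℓ} → Decidable P → ∀ b → P b → ∃ (IsLeast P)
least {P} P? b pb with P? zero
... | yes p0 = zero , p0 , λ _ → z≤n
least {P} P? zero    pb | no ¬p0 = contradiction pb ¬p0
least {P} P? (suc b) pb | no ¬p0 with least (P? ∘ suc) b pb
... | m , pm , below = suc m , pm , below′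
  where
  below′ : ∀ {x} → P x → suc m ≤ x
  below′ {zero}  p0 = contradiction p0 ¬p0
  below′ {suc x} px = s≤s (below px)

-- Colorability is decidable, by search over the finitely many functions
-- between finite sets.  Function extensionality is unavailable, hence the
-- hypothesis that P respects pointwise equality.

anyFun? : ∀ {m n} {P : Pred (Fin m → Fin n) 0ℓ} →
          (∀ {f g} → f ≗ g → P f → P g) → Decidable P → Dec (∃ P)
anyFun? resp P? =
  map′ (λ (i , p) → finToFun i , p)
       (λ (f , p) → funToFin f , resp (sym ∘ Fin.finToFun-funToFin f) p)
       (Fin.any? (P? ∘ finToFun))

isCopy? : ∀ {h n} (H : Graph h) (G : Graph n) → Decidable (IsCopy H G)
isCopy? H G f =
  map′ (λ (inj , pres) → record { injective = inj _ _ ; preserves = pres _ _ })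
       (λ cp → (λ _ _ → IsCopy.injective cp) , (λ _ _ → IsCopy.preserves cp))
       (Fin.all? (λ i → Fin.all? λ j → (f i Fin.≟ f j) →-dec (i Fin.≟ j))
        ×-dec
        Fin.all? (λ i → Fin.all? λ j → adj? H i j →-dec adj? G (f i) (f j)))

isCopy-resp : ∀ {h n} {H : Graph h} {G : Graph n} {f g} →
              f ≗ g → IsCopy H G f → IsCopy H G g
isCopy-resp {G = G} f≗g cp = record
  { injective = λ {i} {j} eq →
      IsCopy.injective cp (trans (f≗g i) (trans eq (sym (f≗g j))))
  ; preserves = λ {i} {j} ij →
      subst₂ (Adj G) (f≗g i) (f≗g j) (IsCopy.preserves cp ij)
  }

bicolored? : ∀ {h n c} (col : Fin n → Fin c) → Decidable (Bicolored {h} col)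
bicolored? col f =
  Fin.any? λ a → Fin.any? λ b → Fin.all? λ i →
    (col (f i) Fin.≟ a) ⊎-dec (col (f i) Fin.≟ b)

bicolored-resp : ∀ {h n c} (col col′ : Fin n → Fin c) (f g : Fin h → Fin n) →
                 col ∘ f ≗ col′ ∘ g → Bicolored col f → Bicolored col′ g
bicolored-resp _ _ _ _ eq (a , b , two) =
  a , b , λ i → subst (λ x → x ≡ a ⊎ x ≡ b) (eq i) (two i)

isPathColoring? : ∀ k {n c} (G : Graph n) →
                  Decidable (IsPathColoring k {c = c} G)
isPathColoring? k G col =
  map′ (λ (prop , free) → record
         { proper = prop _ _ ; noBicolored = λ cp bi → free (_ , cp , bi) })
       (λ pc → (λ _ _ → IsPathColoring.proper pc)
             , (λ (_ , cp , bi) → IsPathColoring.noBicolored pc cp bi))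
       (Fin.all? (λ u → Fin.all? λ v → adj? G u v →-dec ¬? (col u Fin.≟ col v))
        ×-dec
        ¬? (anyFun?
             (λ {f} {g} f≗g (cp , bi) →
               isCopy-resp f≗g cp , bicolored-resp col col f g (cong col ∘ f≗g) bi)
             (λ f → isCopy? (Path k) G f ×-dec bicolored? col f)))

isPathColoring-resp : ∀ {k n c} {G : Graph n} {col col′ : Fin n → Fin c} →
                      col ≗ col′ → IsPathColoring k G col → IsPathColoring k G col′
isPathColoring-resp {col = col} {col′} eq pc = record
  { proper = λ {u} {v} uv same →
      IsPathColoring.proper pc uv (trans (eq u) (trans same (sym (eq v))))
  ; noBicolored = λ {f} cp bi →
      IsPathColoring.noBicolored pc cp (bicolored-resp col′ col f f (sym ∘ eq ∘ f) bi)
  }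

pathColorable? : ∀ k {n} (G : Graph n) → Decidable (PathColorable k G)
pathColorable? k G c = anyFun? isPathColoring-resp (isPathColoring? k G)

-- Giving every vertex its own colour works as soon as k ≥ 3; for k ≤ 2 a graph
-- may have no P_k-coloring at all.

¬bicolored-injective : ∀ {k n} → 3 ≤ k → (f : Fin k → Fin n) →
                       Injective _≡_ _≡_ f → ¬ Bicolored id f
¬bicolored-injective (s≤s (s≤s (s≤s _))) f inj (a , b , two)
  with two zero | two (suc zero) | two (suc (suc zero))
... | inj₁ p | inj₁ q | _      = contradiction (inj (trans p (sym q))) λ ()
... | inj₂ p | inj₂ q | _      = contradiction (inj (trans p (sym q))) λ ()
... | inj₁ p | inj₂ q | inj₁ r = contradiction (inj (trans p (sym r))) λ ()
... | inj₁ p | inj₂ q | inj₂ r = contradiction (inj (trans q (sym r))) λ ()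
... | inj₂ p | inj₁ q | inj₁ r = contradiction (inj (trans q (sym r))) λ ()
... | inj₂ p | inj₁ q | inj₂ r = contradiction (inj (trans p (sym r))) λ ()

discreteColoring : ∀ k {n} (G : Graph n) → 3 ≤ k → PathColorable k G n
discreteColoring k G 3≤k = id , record
  { proper      = λ { uv refl → irrefl G uv }
  ; noBicolored = λ {f} cp → ¬bicolored-injective 3≤k f (IsCopy.injective cp)
  }

leastPathColoring : ∀ k {n} (G : Graph n) → 3 ≤ k → ∃ (IsLeast (PathColorable k G))
leastPathColoring k {n} G 3≤k =
  least (pathColorable? k G) n (discreteColoring k G 3≤k)

pathChromaticNumber : ∀ k {n} → Graph n → 3 ≤ k → ℕ
pathChromaticNumber k G 3≤k = proj₁ (leastPathColoring k G 3≤k)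

pathChromaticNumber-isLeast :
  ∀ k {n} (G : Graph n) (3≤k : 3 ≤ k) →
  IsLeast (PathColorable k G) (pathChromaticNumber k G 3≤k)
pathChromaticNumber-isLeast k G 3≤k = proj₂ (leastPathColoring k G 3≤k)

n*[k∸2]≢0 : ∀ {n k} → 1 ≤ n → 3 ≤ k → NonZero (n * (k ∸ 2))
n*[k∸2]≢0 {n} {k} 1≤n 3≤k =
  ℕ.m*n≢0 n (k ∸ 2) {{>-nonZero 1≤n}} {{>-nonZero (ℕ.m<n⇒0<n∸m 3≤k)}}

{-# OPTIONS --safe #-}
module Submission where

-- In a P_k-coloring, any two colour classes span a triangle-free graph without
-- P_k.  Grow a path in such a graph on a vertex set S for as long as possible; it has at
-- most k − 1 vertices.  If its ends are not adjacent, then the neighbours of its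
-- head lie on the path, are not consecutive and do not include the last vertex, so
-- twice the degree of the head is at most k − 2: remove the head.  If the ends are
-- adjacent, the path closes to a cycle, and an edge leaving the cycle would give a
-- longer path; so its vertices form a component with degrees at most k − 2:
-- remove them all.  By induction S spans at most (k − 2) |S| / 2 edges.  Summing over
-- all pairs of classes gives 2 m ≤ (k − 2) (c − 1) n.

open import Defs
open import Data.Nat.Base using (ℕ; zero; suc; _*_; _∸_; _≤_; _<_; z≤n; s≤s; NonZero)
import Data.Nat.Base as ℕ
import Data.Nat.Properties as ℕ
open import Data.Nat.ListAction using (sum)
open import Data.Nat.ListAction.Properties using (sum-++)
open import Data.Nat.Solver using (module +-*-Solver)
open import Data.Bool.Base using (if_then_else_)
open import Data.Integer.Base using (+_)
import Data.Integer.Base as ℤ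
import Data.Integer.Properties as ℤ
open import Data.Rational.Base using (_/_; _+_; _≥_; 1ℚ)
import Data.Rational.Base as ℚ using (toℚᵘ)
import Data.Rational.Properties as ℚ
open import Data.Rational.Unnormalised.Base using (mkℚᵘ; *≤*)
import Data.Rational.Unnormalised.Base as ℚᵘ using (_+_; 1ℚᵘ)
import Data.Rational.Unnormalised.Properties as ℚᵘ
open import Data.Fin.Base as Fin using (Fin; zero; suc; toℕ)
import Data.Fin.Properties as Fin
open import Data.List.Base
  using (List; []; _∷_; _++_; map; length; filter; lookup; last; head; cartesianProduct; allFin)
open import Data.List.Properties
  using (map-++; map-∘; ++-identityʳ; filter-notAll; length-++; length-tabulate)
open import Data.List.Membership.Propositional using (_∈_; _∉_; find; lose)
open import Data.List.Membership.Propositional.Properties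
  using (∈-∃++; ∈-filter⁺; ∈-filter⁻; ∈-allFin; ∈-lookup)
open import Data.List.Relation.Binary.Subset.Propositional using (_⊆_)
open import Data.List.Relation.Binary.Subset.Propositional.Properties using (∈-∷⁺ʳ; ⊆∷∧∉⇒⊆)
open import Data.List.Relation.Binary.Permutation.Propositional using (_↭_; ↭⇒↭ₛ)
open import Data.List.Relation.Binary.Permutation.Propositional.Properties
  using (shift; ++-comm; ↭-length; ∈-resp-↭)
open import Data.List.Relation.Binary.Permutation.Setoid.Properties using (Unique-resp-↭)
open import Data.List.Relation.Unary.All as All using (All; []; _∷_)
open import Data.List.Relation.Unary.All.Properties using (¬Any⇒All¬; All¬⇒¬Any; ++⁺)
open import Data.List.Relation.Unary.AllPairs using ([]; _∷_)
open import Data.List.Relation.Unary.Any using (here; there; any?)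
open import Data.List.Relation.Unary.Linked as Linked using (Linked; []; [-]; _∷_)
import Data.List.Relation.Unary.Linked.Properties as Linked
open import Data.List.Relation.Unary.Unique.Propositional using (Unique)
import Data.List.Relation.Unary.Unique.Propositional.Properties as Unique
open import Data.Maybe.Base using (just)
open import Data.Maybe.Relation.Binary.Connected using (Connected; just; connected?)
open import Data.Product.Base using (∃₂; _×_; _,_; proj₁; proj₂)
open import Data.Sum.Base using (_⊎_; inj₁; inj₂)
open import Function.Base using (_∘_; id; const)
open import Function.Definitions using (Injective)
open import Induction.WellFounded using (Acc; acc)
open import Data.Nat.Induction using (<-wellFounded)
open import Level using (0ℓ)
open import Relation.Binary.Core using (Rel)
open import Relation.Binary.PropositionalEquality
  using (_≡_; _≢_; refl; sym; trans; cong; cong₂; subst; setoid; module ≡-Reasoning)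
open import Relation.Nullary using (¬_; Dec; yes; no; does; contradiction)
open import Relation.Nullary.Decidable using (¬?; _×-dec_; decidable-stable)
open import Relation.Unary using (Pred; Decidable)
open import Relation.Unary.Properties using (∁?)

open Graph

private
  variable
    A B : Set
    P : Pred A 0ℓ
    R : Rel A 0ℓ
    x y : A
    xs ys : List A

-- Finite sums over lists, with indicator functions.

∑ : List A → (A → ℕ) → ℕ
∑ xs f = sum (map f xs)

⟦_⟧ : Dec B → ℕ
⟦ b? ⟧ = if does b? then 1 else 0

⟦⟧-disjoint : ∀ {P Q R : Set} (p? : Dec P) (q? : Dec Q) (r? : Dec R) →
              (P → ¬ Q) → (P → R) → (Q → R) → ⟦ p? ⟧ ℕ.+ ⟦ q? ⟧ ≤ ⟦ r? ⟧
⟦⟧-disjoint (yes p) (yes q) _       p⇒¬q _   _   = contradiction q (p⇒¬q p)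
⟦⟧-disjoint (yes p) (no _)  (no ¬r) _    p⇒r _   = contradiction (p⇒r p) ¬r
⟦⟧-disjoint (no _)  (yes q) (no ¬r) _    _   q⇒r = contradiction (q⇒r q) ¬r
⟦⟧-disjoint (yes _) (no _)  (yes _) _    _   _   = ℕ.≤-refl
⟦⟧-disjoint (no _)  (yes _) (yes _) _    _   _   = ℕ.≤-refl
⟦⟧-disjoint (no _)  (no _)  _       _    _   _   = z≤n

∑-++ : ∀ (xs ys : List A) f → ∑ (xs ++ ys) f ≡ ∑ xs f ℕ.+ ∑ ys f
∑-++ xs ys f = trans (cong sum (map-++ f xs ys)) (sum-++ (map f xs) (map f ys))

∑-mono : ∀ (xs : List A) {f g} → (∀ {x} → x ∈ xs → f x ≤ g x) → ∑ xs f ≤ ∑ xs g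
∑-mono []       f≤g = z≤n
∑-mono (x ∷ xs) f≤g = ℕ.+-mono-≤ (f≤g (here refl)) (∑-mono xs (f≤g ∘ there))

∑-cong : ∀ (xs : List A) {f g} → (∀ x → f x ≡ g x) → ∑ xs f ≡ ∑ xs g
∑-cong []       f≡g = refl
∑-cong (x ∷ xs) f≡g = cong₂ ℕ._+_ (f≡g x) (∑-cong xs f≡g)

∑-distrib-+ : ∀ (xs : List A) f g → ∑ xs (λ x → f x ℕ.+ g x) ≡ ∑ xs f ℕ.+ ∑ xs g
∑-distrib-+ []       f g = refl
∑-distrib-+ (x ∷ xs) f g rewrite ∑-distrib-+ xs f g =
  solve 4 (λ a b c d → (a :+ b) :+ (c :+ d) := (a :+ c) :+ (b :+ d)) refl
    (f x) (g x) (∑ xs f) (∑ xs g)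
  where open +-*-Solver

∑-const : ∀ (xs : List A) m → ∑ xs (const m) ≡ length xs * m
∑-const []       m = refl
∑-const (x ∷ xs) m = cong (m ℕ.+_) (∑-const xs m)

*-distribˡ-∑ : ∀ m (xs : List A) f → m * ∑ xs f ≡ ∑ xs (λ x → m * f x)
*-distribˡ-∑ m []       f = ℕ.*-zeroʳ m
*-distribˡ-∑ m (x ∷ xs) f =
  trans (ℕ.*-distribˡ-+ m (f x) (∑ xs f)) (cong (m * f x ℕ.+_) (*-distribˡ-∑ m xs f))

∑-swap : ∀ (xs : List A) (ys : List B) (f : A → B → ℕ) →
         ∑ xs (λ x → ∑ ys (f x)) ≡ ∑ ys (λ y → ∑ xs (λ x → f x y))
∑-swap []       ys f = sym (trans (∑-const ys 0) (ℕ.*-zeroʳ (length ys)))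
∑-swap (x ∷ xs) ys f =
  trans (cong (∑ ys (f x) ℕ.+_) (∑-swap xs ys f)) (sym (∑-distrib-+ ys (f x) _))

∑-cartesianProduct : ∀ (xs : List A) (ys : List B) f →
                     ∑ (cartesianProduct xs ys) f ≡ ∑ xs (λ x → ∑ ys (λ y → f (x , y)))
∑-cartesianProduct []       ys f = refl
∑-cartesianProduct (x ∷ xs) ys f =
  trans (∑-++ (map (x ,_) ys) (cartesianProduct xs ys) f)
        (cong₂ ℕ._+_ (cong sum (sym (map-∘ ys))) (∑-cartesianProduct xs ys f))

∑-filter : ∀ (P? : Decidable P) xs f → ∑ (filter P? xs) f ≡ ∑ xs (λ x → ⟦ P? x ⟧ * f x)
∑-filter P? []       f = refl
∑-filter P? (x ∷ xs) f with P? x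
... | yes _ = cong₂ ℕ._+_ (sym (ℕ.*-identityˡ (f x))) (∑-filter P? xs f)
... | no  _ = ∑-filter P? xs f

∑-partition : ∀ (P? : Decidable P) xs f →
              ∑ xs f ≡ ∑ (filter P? xs) f ℕ.+ ∑ (filter (∁? P?) xs) f
∑-partition P? []       f = refl
∑-partition P? (x ∷ xs) f with P? x
... | yes _ = trans (cong (f x ℕ.+_) (∑-partition P? xs f)) (sym (ℕ.+-assoc (f x) _ _))
... | no  _ = trans (cong (f x ℕ.+_) (∑-partition P? xs f))
  (solve 3 (λ a b c → a :+ (b :+ c) := b :+ (a :+ c)) refl (f x) (∑ (filter P? xs) f) _)
  where open +-*-Solver

length-partition : ∀ (P? : Decidable P) xs →
                   length xs ≡ length (filter P? xs) ℕ.+ length (filter (∁? P?) xs)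
length-partition P? []       = refl
length-partition P? (x ∷ xs) with P? x
... | yes _ = cong suc (length-partition P? xs)
... | no  _ = trans (cong suc (length-partition P? xs)) (sym (ℕ.+-suc _ _))

length-filter≡∑ : ∀ (P? : Decidable P) xs → length (filter P? xs) ≡ ∑ xs (λ x → ⟦ P? x ⟧)
length-filter≡∑ P? []       = refl
length-filter≡∑ P? (x ∷ xs) with P? x
... | yes _ = cong suc (length-filter≡∑ P? xs)
... | no  _ = length-filter≡∑ P? xs

∑-δ-∉ : ∀ {c} {a : Fin c} {xs} m → a ∉ xs → ∑ xs (λ b → ⟦ a Fin.≟ b ⟧ * m) ≡ 0
∑-δ-∉ {xs = []} m a∉xs = refl
∑-δ-∉ {a = a} {b ∷ xs} m a∉xs with a Fin.≟ b
... | yes a≡b = contradiction (here a≡b) a∉xs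
... | no  _   = ∑-δ-∉ m (a∉xs ∘ there)

∑-δ : ∀ {c} {a : Fin c} {xs} m → Unique xs → a ∈ xs → ∑ xs (λ b → ⟦ a Fin.≟ b ⟧ * m) ≡ m
∑-δ {a = a} {b ∷ xs} m (b∉xs ∷ uxs) a∈ with a Fin.≟ b | a∈
... | yes refl | _          =
  trans (cong₂ ℕ._+_ (ℕ.*-identityˡ m) (∑-δ-∉ m (All¬⇒¬Any b∉xs))) (ℕ.+-identityʳ m)
... | no  a≢b  | here a≡b   = contradiction a≡b a≢b
... | no  _    | there a∈xs = ∑-δ m uxs a∈xs

-- Once the two sums are exchanged, `∑-δ` leaves for each `x` only the term with `a` equal to `g x`.
∑-fibres : ∀ {c} (g : A → Fin c) xs f →
           ∑ (allFin c) (λ a → ∑ (filter (λ x → g x Fin.≟ a) xs) f) ≡ ∑ xs f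
∑-fibres {c = c} g xs f = begin
  ∑ (allFin c) (λ a → ∑ (filter (λ x → g x Fin.≟ a) xs) f)
    ≡⟨ ∑-cong (allFin c) (λ a → ∑-filter (λ x → g x Fin.≟ a) xs f) ⟩
  ∑ (allFin c) (λ a → ∑ xs (λ x → ⟦ g x Fin.≟ a ⟧ * f x))
    ≡⟨ ∑-swap (allFin c) xs _ ⟩
  ∑ xs (λ x → ∑ (allFin c) (λ a → ⟦ g x Fin.≟ a ⟧ * f x))
    ≡⟨ ∑-cong xs (λ x → ∑-δ (f x) (Unique.allFin⁺ c) (∈-allFin (g x))) ⟩
  ∑ xs f ∎
  where open ≡-Reasoning

-- Duplicate-free lists and linked lists.

-- Induction on `xs`: its head occurs in `ys`, and deleting that occurrence leaves a list which
-- still contains the tail, since the head does not recur there.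
unique-⊆⇒length-≤ : Unique xs → xs ⊆ ys → length xs ≤ length ys
unique-⊆⇒length-≤ {xs = []}     _            _     = z≤n
unique-⊆⇒length-≤ {xs = x ∷ xs} (x∉xs ∷ uxs) xs⊆ys
  with us , vs , refl ← ∈-∃++ (xs⊆ys (here refl)) =
  subst (suc (length xs) ≤_) (sym (↭-length (shift x us vs)))
    (s≤s (unique-⊆⇒length-≤ uxs
      (⊆∷∧∉⇒⊆ (∈-resp-↭ (shift x us vs) ∘ xs⊆ys ∘ there) (All¬⇒¬Any x∉xs))))

lookup-injective : Unique xs → Injective _≡_ _≡_ (lookup xs)
lookup-injective {xs = x ∷ xs} (x∉xs ∷ uxs) {zero}  {zero}  eq = refl
lookup-injective {xs = x ∷ xs} (x∉xs ∷ uxs) {zero}  {suc j} eq =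
  contradiction (subst (_∈ xs) (sym eq) (∈-lookup j)) (All¬⇒¬Any x∉xs)
lookup-injective {xs = x ∷ xs} (x∉xs ∷ uxs) {suc i} {zero}  eq =
  contradiction (subst (_∈ xs) eq (∈-lookup i)) (All¬⇒¬Any x∉xs)
lookup-injective {xs = x ∷ xs} (x∉xs ∷ uxs) {suc i} {suc j} eq =
  cong suc (lookup-injective uxs eq)

linked-lookup : Linked R xs → ∀ {i j} → toℕ j ≡ suc (toℕ i) → R (lookup xs i) (lookup xs j)
linked-lookup (r ∷ rs) {zero}  {suc zero}    _  = r
linked-lookup (r ∷ rs) {suc i} {suc j}       eq = linked-lookup rs (ℕ.suc-injective eq)
linked-lookup [-]      {zero}  {zero}        ()
linked-lookup (r ∷ rs) {zero}  {suc (suc _)} ()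

linked-++⁻ˡ : ∀ xs → Linked R (xs ++ ys) → Linked R xs
linked-++⁻ˡ []           _        = []
linked-++⁻ˡ (x ∷ [])     _        = [-]
linked-++⁻ˡ (x ∷ y ∷ xs) (r ∷ rs) = r ∷ linked-++⁻ˡ (y ∷ xs) rs

linked-++⁻ʳ : ∀ xs → Linked R (xs ++ ys) → Linked R ys
linked-++⁻ʳ []       rs = rs
linked-++⁻ʳ (x ∷ xs) rs = linked-++⁻ʳ xs (Linked.tail rs)

last-++-∷ : ∀ xs {v : A} {ys} → last (xs ++ v ∷ ys) ≡ last (v ∷ ys)
last-++-∷ []           = refl
last-++-∷ (x ∷ [])     = refl
last-++-∷ (x ∷ y ∷ xs) = last-++-∷ (y ∷ xs)

-- The list is read as a cycle and cut open just before `v`: the link from the end of `xs` to `v` is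
-- dropped, and the closing link now joins the end of `v ∷ ys` to the start of `xs`.
linked-rotate : ∀ xs {v : A} {ys} → Linked R (xs ++ v ∷ ys) →
                Connected R (last (xs ++ v ∷ ys)) (head (xs ++ v ∷ ys)) →
                Linked R (v ∷ ys ++ xs)
linked-rotate []              {v} {ys} rs _     = subst (Linked _) (cong (v ∷_) (sym (++-identityʳ ys))) rs
linked-rotate {R = R} (x ∷ xs) {v} {ys} rs close =
  Linked.++⁺ (linked-++⁻ʳ (x ∷ xs) rs)
             (subst (λ z → Connected R z (just x)) (last-++-∷ (x ∷ xs) {v} {ys}) close)
             (linked-++⁻ˡ (x ∷ xs) rs)

-- Each entry satisfying `P` is paired with its successor, which fails `P`. The successor exists
-- because the last entry fails `P`, and the pairs are disjoint.
sparse⇒half : ∀ (P? : Decidable P) {xs} → Linked (λ x y → ¬ (P x × P y)) xs →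
              (∀ {y} → last xs ≡ just y → ¬ P y) → 2 * length (filter P? xs) ≤ length xs
sparse⇒half P? []                 _   = z≤n
sparse⇒half P? {x ∷ []} [-]       end with P? x
... | yes px = contradiction px (end refl)
... | no  _  = z≤n
sparse⇒half P? {x ∷ y ∷ xs} (¬pp ∷ rs) end with P? x
... | no _ = ℕ.m≤n⇒m≤1+n (sparse⇒half P? rs end)
sparse⇒half P? {x ∷ y ∷ []} (¬pp ∷ rs) end | yes px with P? y
... | yes py = contradiction (px , py) ¬pp
... | no  _  = ℕ.≤-refl
sparse⇒half P? {x ∷ y ∷ z ∷ xs} (¬pp ∷ _ ∷ rs) end | yes px with P? y
... | yes py = contradiction (px , py) ¬pp
... | no  _  = subst (_≤ 2 ℕ.+ length (z ∷ xs)) (sym (ℕ.*-suc 2 _)) (s≤s (s≤s (sparse⇒half P? rs end)))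

-- Degrees and edge counts.

module _ {n} (G : Graph n) where

  open import Data.List.Membership.DecPropositional (Fin._≟_ {n}) using (_∈?_)

  degree : List (Fin n) → Fin n → ℕ
  degree ys u = ∑ ys (λ v → ⟦ adj? G u v ⟧)

  -- ∣E∣[ xs , xs ] counts every edge inside xs twice.
  ∣E∣[_,_] : List (Fin n) → List (Fin n) → ℕ
  ∣E∣[ xs , ys ] = ∑ xs (degree ys)

  degree-filter : ∀ u ys → degree ys u ≡ length (filter (adj? G u) ys)
  degree-filter u ys = sym (length-filter≡∑ (adj? G u) ys)

  degree≡0 : ∀ {u} {ys} → (∀ {v} → v ∈ ys → ¬ Adj G u v) → degree ys u ≡ 0
  degree≡0 {u} {[]}     _   = refl
  degree≡0 {u} {v ∷ ys} ¬uv with adj? G u v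
  ... | yes uv = contradiction uv (¬uv (here refl))
  ... | no  _  = degree≡0 (¬uv ∘ there)

  ⟦adj⟧-sym : ∀ u v → ⟦ adj? G u v ⟧ ≡ ⟦ adj? G v u ⟧
  ⟦adj⟧-sym u v with adj? G u v | adj? G v u
  ... | yes _  | yes _  = refl
  ... | no  _  | no  _  = refl
  ... | yes uv | no ¬vu = contradiction (symm G uv) ¬vu
  ... | no ¬uv | yes vu = contradiction (symm G vu) ¬uv

  ∣E∣[]-comm : ∀ xs ys → ∣E∣[ xs , ys ] ≡ ∣E∣[ ys , xs ]
  ∣E∣[]-comm xs ys = trans (∑-swap xs ys _)
    (∑-cong ys λ v → ∑-cong xs λ u → ⟦adj⟧-sym u v)

  -- An edge is listed as an increasing pair, and the double sum meets it as a decreasing pair too.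
  -- The two orientations exclude each other and both imply adjacency, so the comparison is made
  -- term by term.
  handshake : 2 * ∣E∣ G ≤ ∣E∣[ allFin n , allFin n ]
  handshake = begin
    2 * ∣E∣ G
      ≡⟨ cong (λ m → ∣E∣ G ℕ.+ m) (ℕ.+-identityʳ (∣E∣ G)) ⟩
    ∣E∣ G ℕ.+ ∣E∣ G
      ≡⟨ cong₂ ℕ._+_ ∣E∣≡ (trans ∣E∣≡ (∑-swap V V _)) ⟩
    ∑ V (λ u → ∑ V (λ v → ⟦ up? u v ⟧)) ℕ.+ ∑ V (λ u → ∑ V (λ v → ⟦ up? v u ⟧))
      ≡⟨ ∑-distrib-+ V _ _ ⟨
    ∑ V (λ u → ∑ V (λ v → ⟦ up? u v ⟧) ℕ.+ ∑ V (λ v → ⟦ up? v u ⟧))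
      ≡⟨ ∑-cong V (λ u → ∑-distrib-+ V _ _) ⟨
    ∑ V (λ u → ∑ V (λ v → ⟦ up? u v ⟧ ℕ.+ ⟦ up? v u ⟧))
      ≤⟨ ∑-mono V (λ {u} _ → ∑-mono V (λ {v} _ → oneWay u v)) ⟩
    ∣E∣[ V , V ] ∎
    where
    open ℕ.≤-Reasoning
    V : List (Fin n)
    V = allFin n
    up? : ∀ u v → Dec (u Fin.< v × Adj G u v)
    up? u v = (u Fin.<? v) ×-dec adj? G u v
    ∣E∣≡ : ∣E∣ G ≡ ∑ V (λ u → ∑ V (λ v → ⟦ up? u v ⟧))
    ∣E∣≡ = trans (length-filter≡∑ _ (cartesianProduct V V)) (∑-cartesianProduct V V _)
    oneWay : ∀ u v → ⟦ up? u v ⟧ ℕ.+ ⟦ up? v u ⟧ ≤ ⟦ adj? G u v ⟧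
    oneWay u v = ⟦⟧-disjoint (up? u v) (up? v u) (adj? G u v)
      (λ (u<v , _) (v<u , _) → ℕ.<-asym u<v v<u) proj₂ (symm G ∘ proj₂)

  -- The double sum on the right contains the two mixed blocks, which are equal by symmetry.
  ∣E∣[]-++ : ∀ xs ys → 2 * ∣E∣[ xs , ys ] ≤ ∣E∣[ xs ++ ys , xs ++ ys ]
  ∣E∣[]-++ xs ys = begin
    2 * ∣E∣[ xs , ys ]
      ≡⟨ cong (λ m → ∣E∣[ xs , ys ] ℕ.+ m) (trans (ℕ.+-identityʳ _) (∣E∣[]-comm xs ys)) ⟩
    ∣E∣[ xs , ys ] ℕ.+ ∣E∣[ ys , xs ]
      ≤⟨ ℕ.+-mono-≤ (∑-mono xs λ {u} _ → subst (degree ys u ≤_) (sym (∑-++ xs ys _)) (ℕ.m≤n+m _ _))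
                    (∑-mono ys λ {u} _ → subst (degree xs u ≤_) (sym (∑-++ xs ys _)) (ℕ.m≤m+n _ _)) ⟩
    ∑ xs (degree (xs ++ ys)) ℕ.+ ∑ ys (degree (xs ++ ys))
      ≡⟨ ∑-++ xs ys _ ⟨
    ∣E∣[ xs ++ ys , xs ++ ys ] ∎
    where open ℕ.≤-Reasoning

  -- The removal step of the induction. The double count splits into four blocks, and the two mixed
  -- ones are equal; charging everything except the block of `T` with itself to the vertices of `C`
  -- costs each `x` its degree in `C` once and its degree in `T` twice.
  ∣E∣[]-remove : ∀ {Q : Pred (Fin n) 0ℓ} (Q? : Decidable Q) xs d →
                 let C = filter Q? xs; T = filter (∁? Q?) xs in
                 (∀ {x} → x ∈ C → degree C x ℕ.+ 2 * degree T x ≤ d) →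
                 ∣E∣[ T , T ] ≤ length T * d → ∣E∣[ xs , xs ] ≤ length xs * d
  ∣E∣[]-remove Q? xs d light rest = begin
    ∣E∣[ xs , xs ]
      ≡⟨ ∑-cong xs (λ x → ∑-partition Q? xs _) ⟩
    ∑ xs (λ x → degree C x ℕ.+ degree T x)
      ≡⟨ ∑-partition Q? xs _ ⟩
    ∑ C (λ x → degree C x ℕ.+ degree T x) ℕ.+ ∑ T (λ x → degree C x ℕ.+ degree T x)
      ≡⟨ cong₂ ℕ._+_ (∑-distrib-+ C _ _) (∑-distrib-+ T _ _) ⟩
    (∣E∣[ C , C ] ℕ.+ ∣E∣[ C , T ]) ℕ.+ (∣E∣[ T , C ] ℕ.+ ∣E∣[ T , T ])
      ≡⟨ cong (λ m → (∣E∣[ C , C ] ℕ.+ ∣E∣[ C , T ]) ℕ.+ (m ℕ.+ ∣E∣[ T , T ])) (∣E∣[]-comm T C) ⟩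
    (∣E∣[ C , C ] ℕ.+ ∣E∣[ C , T ]) ℕ.+ (∣E∣[ C , T ] ℕ.+ ∣E∣[ T , T ])
      ≡⟨ solve 3 (λ a b c → (a :+ b) :+ (b :+ c) := (a :+ con 2 :* b) :+ c) refl
           ∣E∣[ C , C ] ∣E∣[ C , T ] ∣E∣[ T , T ] ⟩
    (∣E∣[ C , C ] ℕ.+ 2 * ∣E∣[ C , T ]) ℕ.+ ∣E∣[ T , T ]
      ≡⟨ cong (λ m → (∣E∣[ C , C ] ℕ.+ m) ℕ.+ ∣E∣[ T , T ]) (*-distribˡ-∑ 2 C _) ⟩
    (∣E∣[ C , C ] ℕ.+ ∑ C (λ x → 2 * degree T x)) ℕ.+ ∣E∣[ T , T ]
      ≡⟨ cong (ℕ._+ ∣E∣[ T , T ]) (∑-distrib-+ C _ _) ⟨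
    ∑ C (λ x → degree C x ℕ.+ 2 * degree T x) ℕ.+ ∣E∣[ T , T ]
      ≤⟨ ℕ.+-mono-≤ (∑-mono C light) rest ⟩
    ∑ C (const d) ℕ.+ length T * d
      ≡⟨ cong (ℕ._+ length T * d) (∑-const C d) ⟩
    length C * d ℕ.+ length T * d
      ≡⟨ ℕ.*-distribʳ-+ d (length C) (length T) ⟨
    (length C ℕ.+ length T) * d
      ≡⟨ cong (_* d) (length-partition Q? xs) ⟨
    length xs * d ∎
    where
    open ℕ.≤-Reasoning
    open +-*-Solver
    C T : List (Fin n)
    C = filter Q? xs
    T = filter (∁? Q?) xs

  -- Paths inside a vertex set.

  record PathIn (S p : List (Fin n)) : Set where
    field
      linked : Linked (Adj G) p
      unique : Unique p
      inside : p ⊆ S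

  open PathIn

  path-isCopy : ∀ {S p} → PathIn S p → IsCopy (Path (length p)) G (lookup p)
  path-isCopy π = record
    { injective = lookup-injective (unique π)
    ; preserves = λ where
        (inj₁ eq) → linked-lookup (linked π) eq
        (inj₂ eq) → symm G (linked-lookup (linked π) eq)
    }

  extend : ∀ {S w v p} → PathIn S (v ∷ p) → w ∈ S → w ∉ v ∷ p → Adj G w v → PathIn S (w ∷ v ∷ p)
  extend π w∈S w∉p wv = record
    { linked = wv ∷ linked π
    ; unique = ¬Any⇒All¬ _ w∉p ∷ unique π
    ; inside = ∈-∷⁺ʳ w∈S (inside π)
    }

  rotate : ∀ {S} xs {v ys} → PathIn S (xs ++ v ∷ ys) →
           Connected (Adj G) (last (xs ++ v ∷ ys)) (head (xs ++ v ∷ ys)) →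
           PathIn S (v ∷ ys ++ xs)
  rotate xs {v} {ys} π close = record
    { linked = linked-rotate xs (linked π) close
    ; unique = Unique-resp-↭ (setoid (Fin n)) (↭⇒↭ₛ (++-comm xs (v ∷ ys))) (unique π)
    ; inside = inside π ∘ ∈-resp-↭ (++-comm (v ∷ ys) xs)
    }

  -- What is left when a path of S can neither be extended at its head nor, after
  -- being closed to a cycle, be extended at any vertex of that cycle.
  data Stuck (S : List (Fin n)) (v : Fin n) (p : List (Fin n)) : Set where
    open-end : (∀ {w} → w ∈ S → Adj G v w → w ∈ v ∷ p) →
               ¬ Connected (Adj G) (last (v ∷ p)) (just v) → Stuck S v p
    isolated : (∀ {x w} → x ∈ v ∷ p → w ∈ S → Adj G x w → w ∈ v ∷ p) → Stuck S v p

  -- The edge bound for triangle-free graphs without a path on `2 + d` vertices.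

  module _ (d : ℕ) {U : Pred (Fin n) 0ℓ}
           (triangleFree : ∀ {x y z} → U x → U y → U z → Adj G x y → Adj G x z → ¬ Adj G y z)
           (pathFree : ∀ {S p} → All U S → PathIn S p → length p ≢ 2 ℕ.+ d)
           where

    -- Here `m` is the length of the tail of the path. At least one unit of fuel remains, so the
    -- whole path has at most `1 + d` vertices.
    fuel-left : ∀ {m fuel} → suc m ℕ.+ suc fuel ≡ 2 ℕ.+ d → m ≤ d
    fuel-left {m} {fuel} eq =
      ℕ.m+n≤o⇒m≤o m (ℕ.≤-reflexive (ℕ.suc-injective (trans (sym (ℕ.+-suc m fuel)) (ℕ.suc-injective eq))))

    -- The fuel is the number of vertices still missing from a forbidden path. Each extension spends
    -- one unit, and running out would complete such a path, so the search gets stuck earlier.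
    grow : ∀ {S} → All U S → ∀ fuel {v p} → PathIn S (v ∷ p) → length (v ∷ p) ℕ.+ fuel ≡ 2 ℕ.+ d →
           ∃₂ λ v p → PathIn S (v ∷ p) × length p ≤ d × Stuck S v p
    grow US zero π eq =
      contradiction (trans (sym (ℕ.+-identityʳ _)) eq) (pathFree US π)
    grow {S} US (suc fuel) {v} {p} π eq
      with any? (λ w → ¬? (w ∈? (v ∷ p)) ×-dec adj? G w v) S
    ... | yes ext with w , w∈S , w∉p , wv ← find ext =
      grow US fuel (extend π w∈S w∉p wv) (trans (sym (ℕ.+-suc _ fuel)) eq)
    ... | no ¬ext with connected? (adj? G) (last (v ∷ p)) (just v)
    ...   | no ¬close = v , p , π , fuel-left eq , open-end
      (λ w∈S vw → decidable-stable (_ ∈? _) λ w∉p → ¬ext (lose w∈S (w∉p , symm G vw))) ¬close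
    -- A path on two vertices counts as closed too, its only edge being the closing one; rotation
    -- then exchanges its ends.
    ...   | yes close with any? (λ x → any? (λ w → ¬? (w ∈? (v ∷ p)) ×-dec adj? G w x) S) (v ∷ p)
    ...     | no ¬exit = v , p , π , fuel-left eq , isolated
      (λ x∈p w∈S xw → decidable-stable (_ ∈? _) λ w∉p →
        ¬exit (lose x∈p (lose w∈S (w∉p , symm G xw))))
    -- An edge leaves the cycle at `x`: cut the cycle so that `x` becomes the head, then prepend
    -- `w`. The rotated path has the same vertices, so `w` is still new and the length grows by one.
    ...     | yes exit
      with x , x∈p , exit′ ← find exit
      with w , w∈S , w∉p , wx ← find exit′
      with xs , ys , split ← ∈-∃++ x∈p =
      grow US fuel
        (extend (rotate xs (subst (PathIn S) split π)
                  (subst (λ q → Connected (Adj G) (last q) (head q)) split close))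
                w∈S
                (w∉p ∘ ∈-resp-↭ σ)
                wx)
        (trans (cong (λ m → suc m ℕ.+ fuel) (↭-length σ)) (trans (sym (ℕ.+-suc _ fuel)) eq))
      where
      σ : x ∷ ys ++ xs ↭ v ∷ p
      σ = subst (x ∷ ys ++ xs ↭_) (sym split) (++-comm (x ∷ ys) xs)

    -- The neighbours of `v` lie on `p`, irreflexivity excluding `v` itself. Two consecutive ones
    -- would form a triangle with `v`, and the last vertex of `p` is not among them, so
    -- `sparse⇒half` applies to `p`.
    open-end-degree : ∀ {S v p} → All U S → Unique S → PathIn S (v ∷ p) →
                      (∀ {w} → w ∈ S → Adj G v w → w ∈ v ∷ p) →
                      ¬ Connected (Adj G) (last (v ∷ p)) (just v) →
                      2 * degree S v ≤ length p
    open-end-degree {S} {v} {p} US uS π nbrs ¬close = begin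
      2 * degree S v
        ≡⟨ cong (2 *_) (degree-filter v S) ⟩
      2 * length (filter (adj? G v) S)
        ≤⟨ ℕ.*-monoʳ-≤ 2 (unique-⊆⇒length-≤ (Unique.filter⁺ (adj? G v) uS) nbrs′) ⟩
      2 * length (filter (adj? G v) p)
        ≤⟨ sparse⇒half (adj? G v) (noTriangle (Linked.tail (linked π)) (inside π ∘ there)) end ⟩
      length p ∎
      where
      open ℕ.≤-Reasoning
      nbrs′ : filter (adj? G v) S ⊆ filter (adj? G v) p
      nbrs′ w∈ with w∈S , vw ← ∈-filter⁻ (adj? G v) w∈ with nbrs w∈S vw
      ... | here refl = contradiction vw (irrefl G)
      ... | there w∈p = ∈-filter⁺ (adj? G v) w∈p vw
      noTriangle : ∀ {q} → Linked (Adj G) q → q ⊆ S → Linked (λ x y → ¬ (Adj G v x × Adj G v y)) q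
      noTriangle []        _   = []
      noTriangle [-]       _   = [-]
      noTriangle (xy ∷ rs) q⊆S =
        (λ (vx , vy) → triangleFree (All.lookup US (inside π (here refl)))
                                    (All.lookup US (q⊆S (here refl)))
                                    (All.lookup US (q⊆S (there (here refl)))) vx vy xy)
        ∷ noTriangle rs (q⊆S ∘ there)
      end : ∀ {y} → last p ≡ just y → ¬ Adj G v y
      end {y} eq vy = ¬close (subst (λ z → Connected (Adj G) z (just v)) (sym (last-∷ p eq)) (just (symm G vy)))
        where
        last-∷ : ∀ q → last q ≡ just y → last (v ∷ q) ≡ just y
        last-∷ (_ ∷ _) eq = eq

    -- Put in front of its own neighbours, `x` gives a list that is still duplicate-free and lies in
    -- `v ∷ p`; hence the degree plus one is at most `1 + length p`.
    isolated-degree : ∀ {S v p x} → Unique S → x ∈ v ∷ p →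
                      (∀ {x w} → x ∈ v ∷ p → w ∈ S → Adj G x w → w ∈ v ∷ p) →
                      degree S x ≤ length p
    isolated-degree {S} {v} {p} {x} uS x∈p closed =
      subst (_≤ length p) (sym (degree-filter x S))
        (ℕ.s≤s⁻¹ (unique-⊆⇒length-≤
          (¬Any⇒All¬ _ (λ x∈ → irrefl G (proj₂ (∈-filter⁻ (adj? G x) {xs = S} x∈))) ∷ Unique.filter⁺ (adj? G x) uS)
          (∈-∷⁺ʳ x∈p λ w∈ → let w∈S , xw = ∈-filter⁻ (adj? G x) w∈ in closed x∈p w∈S xw)))

    -- Strong induction on the size of `S`, since a whole component may be removed at once. The
    -- conditions on `S` pass to the sublist that remains.
    edge-bound : ∀ S → Acc _<_ (length S) → All U S → Unique S → ∣E∣[ S , S ] ≤ length S * d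
    edge-bound []            _         _  _  = z≤n
    edge-bound S@(s ∷ _) (acc smaller) US@(us ∷ _) uS
      -- The initial path has one vertex, so `suc d` more would make the forbidden `2 + d`.
      with grow US (suc d) {s} {[]}
             (record { linked = [-] ; unique = [] ∷ [] ; inside = ∈-∷⁺ʳ (here refl) λ () }) refl
    ... | v , p , π , short , stuck = go stuck
      where
      remove : ∀ {Q : Pred (Fin n) 0ℓ} (Q? : Decidable Q) → Q v →
               (∀ {x} → x ∈ filter Q? S → degree (filter Q? S) x ℕ.+ 2 * degree (filter (∁? Q?) S) x ≤ d) →
               ∣E∣[ S , S ] ≤ length S * d
      remove Q? qv light = ∣E∣[]-remove Q? S d light
        (edge-bound (filter (∁? Q?) S)
          -- The head `v` lies in `S` and is removed, so what remains is strictly shorter.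
          (smaller (filter-notAll (∁? Q?) S (lose (inside π (here refl)) (λ ¬qv → ¬qv qv))))
          (All.tabulate λ x∈ → All.lookup US (proj₁ (∈-filter⁻ (∁? Q?) x∈)))
          (Unique.filter⁺ (∁? Q?) uS))
      go : Stuck S v p → ∣E∣[ S , S ] ≤ length S * d
      go (open-end nbrs ¬close) = remove (Fin._≟ v) refl light
        where
        light : ∀ {x} → x ∈ filter (Fin._≟ v) S →
                degree (filter (Fin._≟ v) S) x ℕ.+ 2 * degree (filter (∁? (Fin._≟ v)) S) x ≤ d
        light {x} x∈ with refl ← proj₂ (∈-filter⁻ (Fin._≟ v) {xs = S} x∈) = begin
          -- The degree in `C` is doubled as well, so that both terms merge into `2 * degree S v`.
          degree C v ℕ.+ 2 * degree T v      ≤⟨ ℕ.+-monoˡ-≤ _ (ℕ.m≤m+n (degree C v) _) ⟩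
          2 * degree C v ℕ.+ 2 * degree T v  ≡⟨ ℕ.*-distribˡ-+ 2 (degree C v) _ ⟨
          2 * (degree C v ℕ.+ degree T v)    ≡⟨ cong (2 *_) (∑-partition (Fin._≟ v) S _) ⟨
          2 * degree S v                       ≤⟨ open-end-degree US uS π nbrs ¬close ⟩
          length p                             ≤⟨ short ⟩
          d                                    ∎
          where
          open ℕ.≤-Reasoning
          C T : List (Fin n)
          C = filter (Fin._≟ v) S
          T = filter (∁? (Fin._≟ v)) S
      go (isolated closed) = remove (_∈? (v ∷ p)) (here refl) light
        where
        C T : List (Fin n)
        C = filter (_∈? (v ∷ p)) S
        T = filter (∁? (_∈? (v ∷ p))) S
        light : ∀ {x} → x ∈ C → degree C x ℕ.+ 2 * degree T x ≤ d
        -- No edge joins `C` to `T`, so the doubled term vanishes and the degree in `C` is the whole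
        -- degree in `S`.
        light {x} x∈ with x∈S , x∈p ← ∈-filter⁻ (_∈? (v ∷ p)) {xs = S} x∈ = begin
          degree C x ℕ.+ 2 * degree T x  ≡⟨ cong (λ m → degree C x ℕ.+ 2 * m) T≡0 ⟩
          degree C x ℕ.+ 0                ≤⟨ ℕ.+-monoʳ-≤ (degree C x) z≤n ⟩
          degree C x ℕ.+ degree T x      ≡⟨ ∑-partition (_∈? (v ∷ p)) S _ ⟨
          degree S x                       ≤⟨ isolated-degree uS x∈p closed ⟩
          length p                         ≤⟨ short ⟩
          d                                ∎
          where
          open ℕ.≤-Reasoning
          T≡0 : degree T x ≡ 0
          T≡0 = degree≡0 λ w∈ xw →
            let w∈S , w∉p = ∈-filter⁻ (∁? (_∈? (v ∷ p))) w∈ in w∉p (closed x∈p w∈S xw)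

  -- Colour classes and summation over pairs of classes.

  module _ {c} (col : Fin n → Fin c) where

    class : Fin c → List (Fin n)
    class a = filter (λ u → col u Fin.≟ a) (allFin n)

    class-colour : ∀ {a u} → u ∈ class a → col u ≡ a
    class-colour {a} u∈ = proj₂ (∈-filter⁻ (λ u → col u Fin.≟ a) {xs = allFin n} u∈)

    class-unique : ∀ a → Unique (class a)
    class-unique a = Unique.filter⁺ (λ u → col u Fin.≟ a) (Unique.allFin⁺ n)

    ∑-length-class : ∑ (allFin c) (length ∘ class) ≡ n
    ∑-length-class = begin
      ∑ (allFin c) (length ∘ class)
        ≡⟨ ∑-cong (allFin c) (λ a → trans (sym (ℕ.*-identityʳ _)) (sym (∑-const (class a) 1))) ⟩
      ∑ (allFin c) (λ a → ∑ (class a) (const 1))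
        ≡⟨ ∑-fibres col (allFin n) (const 1) ⟩
      ∑ (allFin n) (const 1)
        ≡⟨ ∑-const (allFin n) 1 ⟩
      length (allFin n) * 1
        ≡⟨ ℕ.*-identityʳ _ ⟩
      length (allFin n)
        ≡⟨ length-tabulate id ⟩
      n ∎
      where open ≡-Reasoning

    -- Each ordered pair of vertices lies in exactly one ordered pair of classes; `∑-fibres`
    -- collects first the second vertex, then the first.
    ∑-∣E∣-class : ∑ (allFin c) (λ a → ∑ (allFin c) (λ b → ∣E∣[ class a , class b ])) ≡
                  ∣E∣[ allFin n , allFin n ]
    ∑-∣E∣-class = begin
      ∑ (allFin c) (λ a → ∑ (allFin c) (λ b → ∣E∣[ class a , class b ]))
        ≡⟨ ∑-cong (allFin c) (λ a → ∑-swap (allFin c) (class a) _) ⟩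
      ∑ (allFin c) (λ a → ∑ (class a) (λ u → ∑ (allFin c) (λ b → degree (class b) u)))
        ≡⟨ ∑-cong (allFin c) (λ a → ∑-cong (class a) (λ u → ∑-fibres col (allFin n) _)) ⟩
      ∑ (allFin c) (λ a → ∑ (class a) (degree (allFin n)))
        ≡⟨ ∑-fibres col (allFin n) _ ⟩
      ∣E∣[ allFin n , allFin n ] ∎
      where open ≡-Reasoning

    ∣E∣-class≡0 : Proper G col → ∀ a → ∣E∣[ class a , class a ] ≡ 0
    ∣E∣-class≡0 proper a = ℕ.n≤0⇒n≡0 (begin
      ∣E∣[ class a , class a ]  ≤⟨ ∑-mono (class a) (λ u∈ → ℕ.≤-reflexive (degree≡0 λ v∈ uv →
                                     proper uv (trans (class-colour u∈) (sym (class-colour v∈))))) ⟩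
      ∑ (class a) (const 0)     ≡⟨ ∑-const (class a) 0 ⟩
      length (class a) * 0      ≡⟨ ℕ.*-zeroʳ (length (class a)) ⟩
      0                         ∎)
      where open ℕ.≤-Reasoning

    -- By the pigeonhole principle two of the three vertices share a colour, so the edge between
    -- them is not properly coloured.
    two-coloured-triangleFree : Proper G col → ∀ {a b x y z} →
      col x ≡ a ⊎ col x ≡ b → col y ≡ a ⊎ col y ≡ b → col z ≡ a ⊎ col z ≡ b →
      Adj G x y → Adj G x z → ¬ Adj G y z
    two-coloured-triangleFree proper (inj₁ x) (inj₁ y) _        xy _  _  = proper xy (trans x (sym y))
    two-coloured-triangleFree proper (inj₁ x) (inj₂ y) (inj₁ z) _  xz _  = proper xz (trans x (sym z))
    two-coloured-triangleFree proper (inj₁ x) (inj₂ y) (inj₂ z) _  _  yz = proper yz (trans y (sym z))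
    two-coloured-triangleFree proper (inj₂ x) (inj₂ y) _        xy _  _  = proper xy (trans x (sym y))
    two-coloured-triangleFree proper (inj₂ x) (inj₁ y) (inj₂ z) _  xz _  = proper xz (trans x (sym z))
    two-coloured-triangleFree proper (inj₂ x) (inj₁ y) (inj₁ z) _  _  yz = proper yz (trans y (sym z))

    two-coloured-pathFree : ∀ {k} → IsPathColoring k G col → ∀ {a b S p} →
      All (λ u → col u ≡ a ⊎ col u ≡ b) S → PathIn S p → length p ≢ k
    two-coloured-pathFree pc two π refl = IsPathColoring.noBicolored pc (path-isCopy π)
      (_ , _ , λ i → All.lookup two (inside π (∈-lookup i)))

    -- The δ-term makes up for the diagonal pairs, whose classes span no edges, so
    -- that the bound can be summed over all c² pairs of colours.
    ∣E∣-classes : ∀ {d} → IsPathColoring (2 ℕ.+ d) G col → ∀ a b →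
                  2 * ∣E∣[ class a , class b ] ℕ.+ ⟦ a Fin.≟ b ⟧ * (2 * (length (class a) * d)) ≤
                  (length (class a) ℕ.+ length (class b)) * d
    ∣E∣-classes {d} pc a b with a Fin.≟ b
    ... | yes refl rewrite ∣E∣-class≡0 (IsPathColoring.proper pc) a =
      ℕ.≤-reflexive (solve 2 (λ l d → con 1 :* (con 2 :* (l :* d)) := (l :+ l) :* d) refl (length (class a)) d)
      where open +-*-Solver
    ... | no a≢b = begin
      2 * ∣E∣[ class a , class b ] ℕ.+ 0
        ≡⟨ ℕ.+-identityʳ _ ⟩
      2 * ∣E∣[ class a , class b ]
        ≤⟨ ∣E∣[]-++ (class a) (class b) ⟩
      ∣E∣[ class a ++ class b , class a ++ class b ]
        ≤⟨ edge-bound d (two-coloured-triangleFree (IsPathColoring.proper pc)) (two-coloured-pathFree pc)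
             (class a ++ class b) (<-wellFounded _)
             (++⁺ (All.tabulate (inj₁ ∘ class-colour)) (All.tabulate (inj₂ ∘ class-colour)))
             (Unique.++⁺ (class-unique a) (class-unique b)
               λ (u∈a , u∈b) → a≢b (trans (sym (class-colour u∈a)) (class-colour u∈b))) ⟩
      length (class a ++ class b) * d
        ≡⟨ cong (_* d) (length-++ (class a)) ⟩
      (length (class a) ℕ.+ length (class b)) * d ∎
      where open ℕ.≤-Reasoning

    -- This is `2m ≤ (c - 1) n d` with the subtraction moved to the left. Everything is doubled
    -- first because `∣E∣-classes` bounds twice the count between two classes.
    colouring-bound : ∀ {d} → IsPathColoring (2 ℕ.+ d) G col → 2 * ∣E∣ G ℕ.+ n * d ≤ c * (n * d)
    colouring-bound {d} pc = ℕ.*-cancelˡ-≤ 2 (begin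
      2 * (2 * ∣E∣ G ℕ.+ n * d)
        ≤⟨ ℕ.*-monoʳ-≤ 2 (ℕ.+-monoˡ-≤ (n * d) handshake) ⟩
      2 * (∣E∣[ allFin n , allFin n ] ℕ.+ n * d)
        ≡⟨ cong (2 *_) (cong₂ ℕ._+_ (sym ∑-∣E∣-class) ∑-size) ⟩
      2 * (∑ C (λ a → ∑ C (λ b → ∣E∣[ class a , class b ])) ℕ.+ ∑ C (λ a → size a * d))
        ≡⟨ trans (cong (2 *_) (sym (∑-distrib-+ C _ _))) (*-distribˡ-∑ 2 C _) ⟩
      ∑ C (λ a → 2 * (∑ C (λ b → ∣E∣[ class a , class b ]) ℕ.+ size a * d))
        ≡⟨ ∑-cong C row ⟩
      ∑ C (λ a → ∑ C (λ b → 2 * ∣E∣[ class a , class b ] ℕ.+ ⟦ a Fin.≟ b ⟧ * (2 * (size a * d))))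
        ≤⟨ ∑-mono C (λ {a} _ → ∑-mono C λ {b} _ → ∣E∣-classes pc a b) ⟩
      ∑ C (λ a → ∑ C (λ b → (size a ℕ.+ size b) * d))
        ≡⟨ ∑-cong C (λ a → trans (∑-cong C λ b → ℕ.*-distribʳ-+ d (size a) (size b)) (∑-distrib-+ C _ _)) ⟩
      ∑ C (λ a → ∑ C (λ b → size a * d) ℕ.+ ∑ C (λ b → size b * d))
        ≡⟨ ∑-distrib-+ C _ _ ⟩
      ∑ C (λ a → ∑ C (λ b → size a * d)) ℕ.+ ∑ C (λ a → ∑ C (λ b → size b * d))
        -- Exchanging the sums turns `size a` into `size b`, so that both halves equal
        -- `c * (n * d)`.
        ≡⟨ cong (ℕ._+ ∑ C (λ a → ∑ C (λ b → size b * d))) (∑-swap C C _) ⟩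
      ∑ C (λ a → ∑ C (λ b → size b * d)) ℕ.+ ∑ C (λ a → ∑ C (λ b → size b * d))
        ≡⟨ cong (λ m → m ℕ.+ m) (trans (∑-cong C λ _ → sym ∑-size) (∑-const C (n * d))) ⟩
      length C * (n * d) ℕ.+ length C * (n * d)
        ≡⟨ cong (λ m → m * (n * d) ℕ.+ m * (n * d)) (length-tabulate {n = c} id) ⟩
      c * (n * d) ℕ.+ c * (n * d)
        ≡⟨ cong (λ m → c * (n * d) ℕ.+ m) (ℕ.+-identityʳ _) ⟨
      2 * (c * (n * d)) ∎)
      where
      open ℕ.≤-Reasoning
      C : List (Fin c)
      C = allFin c
      size : Fin c → ℕ
      size a = length (class a)
      ∑-size : n * d ≡ ∑ C (λ a → size a * d)
      ∑-size = begin-equality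
        n * d                     ≡⟨ cong (_* d) ∑-length-class ⟨
        ∑ C size * d              ≡⟨ ℕ.*-comm (∑ C size) d ⟩
        d * ∑ C size              ≡⟨ *-distribˡ-∑ d C size ⟩
        ∑ C (λ a → d * size a)    ≡⟨ ∑-cong C (λ a → ℕ.*-comm d (size a)) ⟩
        ∑ C (λ a → size a * d)    ∎
      -- The extra term of row `a` is spread over `b` by an indicator supported at `b` equal to `a`,
      -- to match the left side of `∣E∣-classes` term by term.
      row : ∀ a → 2 * (∑ C (λ b → ∣E∣[ class a , class b ]) ℕ.+ size a * d) ≡
                  ∑ C (λ b → 2 * ∣E∣[ class a , class b ] ℕ.+ ⟦ a Fin.≟ b ⟧ * (2 * (size a * d)))
      row a = begin-equality
        2 * (∑ C (λ b → ∣E∣[ class a , class b ]) ℕ.+ size a * d)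
          ≡⟨ ℕ.*-distribˡ-+ 2 (∑ C (λ b → ∣E∣[ class a , class b ])) (size a * d) ⟩
        2 * ∑ C (λ b → ∣E∣[ class a , class b ]) ℕ.+ 2 * (size a * d)
          ≡⟨ cong₂ ℕ._+_ (*-distribˡ-∑ 2 C _) (sym (∑-δ _ (Unique.allFin⁺ c) (∈-allFin a))) ⟩
        ∑ C (λ b → 2 * ∣E∣[ class a , class b ]) ℕ.+ ∑ C (λ b → ⟦ a Fin.≟ b ⟧ * (2 * (size a * d)))
          ≡⟨ ∑-distrib-+ C _ _ ⟨
        ∑ C (λ b → 2 * ∣E∣[ class a , class b ] ℕ.+ ⟦ a Fin.≟ b ⟧ * (2 * (size a * d))) ∎

-- Passage to rational numbers.

-- The fractions in `ℚ` are reduced to lowest terms; in the unnormalised rationals numerators and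
-- denominators stay explicit, and the claim becomes the integer inequality `m + N ≤ c * N`.
/-+-1-≤ : ∀ m N c .{{_ : NonZero N}} → m ℕ.+ N ≤ c * N → (+ c) / 1 ≥ (+ m) / N + 1ℚ
/-+-1-≤ m N@(suc N-1) c m+N≤cN = ℚ.toℚᵘ-cancel-≤ (begin
  ℚ.toℚᵘ ((+ m) / N + 1ℚ)
    ≃⟨ ℚ.toℚᵘ-homo-+ ((+ m) / N) 1ℚ ⟩
  ℚ.toℚᵘ ((+ m) / N) ℚᵘ.+ ℚᵘ.1ℚᵘ
    ≃⟨ ℚᵘ.+-congˡ ℚᵘ.1ℚᵘ (ℚ.toℚᵘ-fromℚᵘ (mkℚᵘ (+ m) N-1)) ⟩
  mkℚᵘ (+ m) N-1 ℚᵘ.+ ℚᵘ.1ℚᵘ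
    ≤⟨ *≤* (numerators m+N≤cN) ⟩
  mkℚᵘ (+ c) 0
    ≃⟨ ℚ.toℚᵘ-fromℚᵘ (mkℚᵘ (+ c) 0) ⟨
  ℚ.toℚᵘ ((+ c) / 1) ∎)
  where
  open ℚᵘ.≤-Reasoning
  -- Cross-multiplication of `(m * 1 + 1 * N) / (N * 1)` with `c / 1`.
  numerators : ∀ {N} → m ℕ.+ N ≤ c * N →
               ((+ m) ℤ.* (+ 1) ℤ.+ (+ 1) ℤ.* (+ N)) ℤ.* (+ 1) ℤ.≤ (+ c) ℤ.* (+ (N * 1))
  numerators {N} m+N≤cN
    rewrite ℤ.*-identityʳ ((+ m) ℤ.* (+ 1) ℤ.+ (+ 1) ℤ.* (+ N))
          | ℤ.*-identityʳ (+ m) | ℤ.*-identityˡ (+ N) | ℕ.*-identityʳ N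
          | sym (ℤ.pos-* c N) = ℤ.+≤+ m+N≤cN

theorem2 : ∀ {n : ℕ} (G : Graph n) → (1≤n : 1 ≤ n) →
    ∀ (k : ℕ) → (3≤k : 3 ≤ k) →
    (+ pathChromaticNumber k G 3≤k) / 1
    ≥ ((+ (2 * ∣E∣ G)) / (n * (k ∸ 2))) {{n*[k∸2]≢0 1≤n 3≤k}} + 1ℚ
theorem2 _ _ (suc zero) (s≤s ())
-- With `k` written as `2 + d`, `k ∸ 2` computes to `d`, and the bound is applied to a colouring
-- with the least number of colours.
theorem2 {n} G 1≤n k@(suc (suc d)) 3≤k =
  /-+-1-≤ (2 * ∣E∣ G) (n * d) (pathChromaticNumber k G 3≤k) {{n*[k∸2]≢0 1≤n 3≤k}}
    (colouring-bound G _ (proj₂ (proj₁ (pathChromaticNumber-isLeast k G 3≤k))))
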